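{- Let $t$ be an indeterminate, and let $F_n^{(a)}(q)$ ($n\ge 0$) be the $q$-Fibonacci numbers with parameter $a$. For every integer $n\ge 0$, $$1+\sum_{k=1}^n t^{k-1} \left( q^{a+k-1}F^{(a)}_{k-1}(q) +(t-1)F^{(a)}_{k+1}(q)\right) =t^nF^{(a)}_{n+1}(q).$$
   Context: The $q$-Fibonacci numbers with parameter $a$ are defined by $F_0^{(a)}(q)=0$, $F_1^{(a)}(q)=1$, and $F_{n+2}^{(a)}(q) = F_{n+1}^{(a)}(q) + q^{a+n} F_n^{(a)}(q)$ for $n\ge 0$. Here $q$ is a nonzero complex number (or an indeterminate), and $q^{a+m}$ means $q^a\cdot q^m$ for a fixed nonzero value $q^a$. Empty sums equal $0$. -}

module Defs where

open import Level using (Level)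
open import Data.Nat.Base using (ℕ; zero; suc)
open import Data.Fin.Base using (Fin; toℕ)
open import Algebra.Bundles using (CommutativeRing)

-- The ring R contains q, the value qᵃ and t.  It is arbitrary, so t being an
-- indeterminate is the case where R is a polynomial ring in t; the same goes for q.
module QFibonacci {c ℓ : Level} (R : CommutativeRing c ℓ) where

  open CommutativeRing R
  open import Algebra.Properties.Semiring.Exp semiring using (_^_)
  open import Algebra.Properties.Semiring.Sum semiring using (sum)

  -- q^{a+m}: the exponent a enters only through the fixed value qᵃ.
  q^[a+_] : ℕ → (q qᵃ : Carrier) → Carrier
  q^[a+ m ] q qᵃ = qᵃ * q ^ m

  F : (q qᵃ : Carrier) → ℕ → Carrier
  F q qᵃ zero          = 0#
  F q qᵃ (suc zero)    = 1#
  F q qᵃ (suc (suc n)) = F q qᵃ (suc n) + (q^[a+ n ] q qᵃ) * F q qᵃ n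

  -- ∑₁ n f = f 1 + ⋯ + f n
  ∑₁ : ℕ → (ℕ → Carrier) → Carrier
  ∑₁ n f = sum {n} (λ (i : Fin n) → f (suc (toℕ i)))

-- Write G k = tᵏ F_{k+1}.  Since F_{k+2} = F_{k+1} + q^{a+k} F_k, the summand of index k + 1
-- is G (k + 1) - G k, so the sum telescopes from G 0 = 1 to G n.
module Submission where

open import Defs
open import Level using (Level)
open import Data.Nat.Base using (ℕ; zero; suc; _∸_)
open import Data.Fin.Base using (toℕ)
open import Algebra.Bundles using (CommutativeRing)
open import Relation.Nullary using (¬_)
import Algebra.Properties.Semiring.Exp
import Algebra.Properties.Semiring.Sum
import Relation.Binary.Reasoning.Setoid

module _ {c ℓ : Level} (R : CommutativeRing c ℓ) where

  open CommutativeRing R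
  open Algebra.Properties.Semiring.Exp semiring using (_^_)
  open Algebra.Properties.Semiring.Sum semiring using (sum)
  open QFibonacci R
  open Relation.Binary.Reasoning.Setoid setoid

  -- With `y` = F_{k+1} and `x` = q^{a+k} F_k, the recurrence reads F_{k+2} = `y + x`. Adding
  -- (t-1)F_{k+2} to `y + x` gives t F_{k+2}, so adding the summand of index k+1 to t^k F_{k+1}
  -- turns it into t^{k+1} F_{k+2}. `telescope` iterates this step, which
  -- `py+p[x+[t-1][y+x]]≈tp[y+x]` supplies.

  telescope : (G f : ℕ → Carrier) → (∀ k → G k + f k ≈ G (suc k)) →
              ∀ n → G 0 + sum {n} (λ i → f (toℕ i)) ≈ G n
  telescope G f step zero    = +-identityʳ (G 0)
  telescope G f step (suc n) = begin
    G 0 + (f 0 + rest)  ≈⟨ +-assoc (G 0) (f 0) rest ⟨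
    (G 0 + f 0) + rest  ≈⟨ +-congʳ (step 0) ⟩
    -- `sum` splits off its first term, so the induction shifts `G` and `f` by one and restarts from
    -- `G 1`.
    G 1 + rest          ≈⟨ telescope (λ k → G (suc k)) (λ k → f (suc k)) (λ k → step (suc k)) n ⟩
    G (suc n)           ∎
    where
    rest : Carrier
    rest = sum {n} (λ i → f (suc (toℕ i)))

  z+[t-1]z≈tz : ∀ t z → z + (t - 1#) * z ≈ t * z
  z+[t-1]z≈tz t z = begin
    z + (t - 1#) * z       ≈⟨ +-congʳ (*-identityˡ z) ⟨
    1# * z + (t - 1#) * z  ≈⟨ distribʳ z 1# (t - 1#) ⟨
    (1# + (t - 1#)) * z    ≈⟨ *-congʳ (+-comm 1# (t - 1#)) ⟩
    ((t - 1#) + 1#) * z    ≈⟨ *-congʳ (+-assoc t (- 1#) 1#) ⟩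
    (t + (- 1# + 1#)) * z  ≈⟨ *-congʳ (+-congˡ (-‿inverseˡ 1#)) ⟩
    (t + 0#) * z           ≈⟨ *-congʳ (+-identityʳ t) ⟩
    t * z                  ∎

  -- One telescoping step with the power of t abstracted to `p`; only ring laws remain, since the
  -- recurrence is built into `y + x`.
  py+p[x+[t-1][y+x]]≈tp[y+x] : ∀ t p x y →
    p * y + p * (x + (t - 1#) * (y + x)) ≈ (t * p) * (y + x)
  py+p[x+[t-1][y+x]]≈tp[y+x] t p x y = begin
    p * y + p * (x + (t - 1#) * (y + x))  ≈⟨ distribˡ p y _ ⟨
    p * (y + (x + (t - 1#) * (y + x)))    ≈⟨ *-congˡ (+-assoc y x _) ⟨
    p * ((y + x) + (t - 1#) * (y + x))    ≈⟨ *-congˡ (z+[t-1]z≈tz t (y + x)) ⟩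
    p * (t * (y + x))                     ≈⟨ *-assoc p t (y + x) ⟨
    (p * t) * (y + x)                     ≈⟨ *-congʳ (*-comm p t) ⟩
    (t * p) * (y + x)                     ∎

  weightedFibonacciSum : ∀ q qᵃ t n →
    1# + ∑₁ n (λ k → t ^ (k ∸ 1) *
                       ((q^[a+ k ∸ 1 ] q qᵃ) * F q qᵃ (k ∸ 1)
                         + (t - 1#) * F q qᵃ (suc k)))
      ≈ t ^ n * F q qᵃ (suc n)
  -- The leading `1#` becomes `1# * 1#`, to which t^0 F_1 reduces.
  weightedFibonacciSum q qᵃ t n = trans (+-congʳ (sym (*-identityˡ 1#)))
    (telescope (λ k → t ^ k * F q qᵃ (suc k)) _
      (λ k → py+p[x+[t-1][y+x]]≈tp[y+x] t (t ^ k) ((q^[a+ k ] q qᵃ) * F q qᵃ k) (F q qᵃ (suc k))) n)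

mainTheorem10 : ∀ {c ℓ : Level} (R : CommutativeRing c ℓ) →
    let open CommutativeRing R
        open Algebra.Properties.Semiring.Exp semiring using (_^_)
        open QFibonacci R
    in (q qᵃ t : Carrier) → ¬ (q ≈ 0#) → ¬ (qᵃ ≈ 0#) → (n : ℕ) →
       1# + ∑₁ n (λ k → t ^ (k ∸ 1) *
                          ((q^[a+ k ∸ 1 ] q qᵃ) * F q qᵃ (k ∸ 1)
                            + (t - 1#) * F q qᵃ (suc k)))
         ≈ t ^ n * F q qᵃ (suc n)
mainTheorem10 R q qᵃ t _ _ n = weightedFibonacciSum R q qᵃ t n
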